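{- Let $n>k\geq 3$ be integers and let $\mathcal{A}_{k+1}$ denote the antichain on $k+1$ elements. Then $$3n-1 \leq \mathrm{sat}^*(n,\mathcal{A}_{k+1}) \leq (n-1)k-\left( \tfrac{1}{2} \log_2 k + \tfrac{1}{2} \log_2 \log_2 k + O(1)\right).$$ In particular, $\mathrm{sat}^*(n,\mathcal{A}_{k+1})=\Theta(n)$.
   Context: $\mathcal{B}_n$ is the Boolean lattice $(2^{[n]},\subseteq)$, $[n]=\{1,\dots,n\}$. A poset $\mathcal{P}'=(P',\le')$ is an induced subposet of $\mathcal{P}=(P,\le)$ if there is an injection $f:P'\to P$ with $u\le' v$ if and only if $f(u)\le f(v)$. For a family $\mathcal{F}\subseteq 2^{[n]}$, the poset induced by $\mathcal{F}$ is $\mathcal{F}$ ordered by inclusion. A family $\mathcal{F}\subseteq 2^{[n]}$ is induced-$\mathcal{P}$-saturated in $\mathcal{B}_n$ if the poset induced by $\mathcal{F}$ contains no induced copy of $\mathcal{P}$, but for every $\mathcal{F}'$ with $\mathcal{F}\subsetneq\mathcal{F}'\subseteq 2^{[n]}$ the poset induced by $\mathcal{F}'$ contains an induced copy of $\mathcal{P}$. $\mathrm{sat}^*(n,\mathcal{P})$ denotes the minimum size of an induced-$\mathcal{P}$-saturated family in $\mathcal{B}_n$. The $O(1)$ term is a quantity bounded by an absolute constant (as $k$ varies). -}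

module Defs where

open import Data.Nat using (ℕ; suc; _+_; _*_; _∸_; _^_; _≤_; _<_)
open import Data.Fin using (Fin)
open import Data.Fin.Subset using (Subset; _⊆_)
open import Data.List using (List; length)
open import Data.List.Membership.Propositional using (_∈_; _∉_)
open import Data.List.Relation.Unary.Unique.Propositional using (Unique)
open import Data.Product using (Σ; ∃; _×_)
open import Function.Definitions using (Injective)
open import Relation.Binary.PropositionalEquality using (_≡_)
open import Relation.Nullary using (¬_)

record Family (n : ℕ) : Set where
  constructor family
  field
    members : List (Subset n)
    unique  : Unique members
open Family public

∣_∣F : ∀ {n} → Family n → ℕ
∣ F ∣F = length (members F)

_∈F_ : ∀ {n} → Subset n → Family n → Set
S ∈F F = S ∈ members F

_⊊F_ : ∀ {n} → Family n → Family n → Set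
F ⊊F F' = (∀ {S} → S ∈F F → S ∈F F') × Σ _ (λ S → S ∈F F' × ¬ (S ∈F F))

record FinPoset : Set₁ where
  field
    size  : ℕ
    _≤P_  : Fin size → Fin size → Set
    refl  : ∀ i → i ≤P i
    antisym : ∀ {i j} → i ≤P j → j ≤P i → i ≡ j
    trans : ∀ {i j l} → i ≤P j → j ≤P l → i ≤P l
open FinPoset public

ContainsInduced : ∀ {n} → FinPoset → Family n → Set
ContainsInduced P F =
  Σ (Fin (size P) → Subset _) λ f →
    Injective _≡_ _≡_ f × (∀ i → f i ∈F F) ×
    (∀ i j → (_≤P_ P i j → f i ⊆ f j) × (f i ⊆ f j → _≤P_ P i j))

IsInducedSaturated : (n : ℕ) → FinPoset → Family n → Set
IsInducedSaturated n P F =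
  ¬ ContainsInduced P F × (∀ (F' : Family n) → F ⊊F F' → ContainsInduced P F')

antichain : ℕ → FinPoset
antichain m = record
  { size = m ; _≤P_ = _≡_
  ; refl = λ _ → Relation.Binary.PropositionalEquality.refl
  ; antisym = λ p _ → p
  ; trans = Relation.Binary.PropositionalEquality.trans }

SatStar≥ : ℕ → FinPoset → ℕ → Set
SatStar≥ n P m = ∀ (F : Family n) → IsInducedSaturated n P F → m ≤ ∣ F ∣F

SatStar≤ : ℕ → FinPoset → ℕ → Set
SatStar≤ n P m = Σ (Family n) λ F → IsInducedSaturated n P F × ∣ F ∣F ≤ m

{-# OPTIONS --safe #-}
module Submission where

-- Lower bound.  By Dilworth's theorem a saturated family F is covered by k chains; extending
-- them to full chains keeps the width at most k, so by saturation F contains the full chains.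
-- If some inner level m of F had at most two sets X and Y, two of the k ≥ 3 chains would agree
-- at level m, say at X.  Let u (respectively v) be one of two elements by which these chains
-- last differ below (first differ above) X.  If Z = X - u + v is not in F, some k-antichain of F
-- is incomparable to Z; it meets the two chains on the same side of X, hence in a set comparable
-- to Z.  So every such Z equals Y, although there are two of them.  Hence every inner level has
-- at least three sets.
--
-- Upper bound.  The pairs {j mod 2, 2 + ⌊j/2⌋}, j < k, form an antichain of size k on about k/2
-- points.  A saturated family containing it has no singleton outside these points, and at most k
-- sets on every other level, which saves about k/2 ≥ ½ log₂ (k log₂ k) - O(1) sets.

open import Defs hiding (refl; trans; antisym; size)
open import Data.Bool.Properties as Boolₚ using ()
open import Data.Empty as Empty using (⊥-elim)
open import Data.Fin as Fin using (Fin; zero; suc; toℕ; fromℕ<; inject≤; punchIn; punchOut)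
open import Data.Fin.Properties as Finₚ
  using (toℕ-injective; toℕ<n; toℕ-fromℕ<; fromℕ<-injective; inject≤-injective; punchInᵢ≢i;
         punchIn-injective; punchOut-injective; injective⇒≤)
open import Data.Fin.Subset using (Subset; inside; outside; ⊥; ⊤; ⁅_⁆; ∣_∣; _⊆_; _∪_; _-_)
  renaming (_∈_ to _∈ˢ_; _∉_ to _∉ˢ_)
open import Data.Fin.Subset.Properties renaming (_∈?_ to _∈ˢ?_)
open import Data.List using (List; []; _∷_; _++_; length; filter; lookup; map; tabulate)
import Data.List.Membership.DecPropositional as DecMembership
open import Data.List.Membership.Propositional using (_∈_; _∉_; find; lose)
open import Data.List.Membership.Propositional.Properties
  using (∈-filter⁺; ∈-filter⁻; ∈-lookup; ∈-map⁺; ∈-++⁺ˡ; ∈-++⁺ʳ; ∈-tabulate⁺; ∈-tabulate⁻; ∈-length)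
open import Data.List.Properties using (length-filter; filter-all; filter-none; filter-notAll)
open import Data.List.Relation.Unary.All as All using (_∷_)
open import Data.List.Relation.Unary.All.Properties using (¬Any⇒All¬)
open import Data.List.Relation.Unary.AllPairs using (_∷_)
open import Data.List.Relation.Unary.Any as Any using (here; there)
open import Data.List.Relation.Unary.Unique.Propositional using (Unique)
import Data.List.Relation.Unary.Unique.Propositional.Properties as Uniqueₚ
open import Data.Nat as ℕ using (ℕ; zero; suc; _+_; _*_; _∸_; _^_; _≤_; _<_; z≤n; s≤s; >-nonZero)
open import Data.Nat.DivMod using (_/_; _%_; m%n<n; m≡m%n+[m/n]*n; m/n<m; m/n≤m; m/n*n≤m; /-monoˡ-≤)
open import Data.Nat.Induction using (Acc; acc; <-wellFounded)
open import Data.Nat.Properties as ℕₚ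
open import Data.Nat.Tactic.RingSolver using (solve-∀)
open import Data.Product using (Σ; ∃; _×_; _,_; proj₁; proj₂)
open import Data.Sum using (_⊎_; inj₁; inj₂; swap; [_,_]′)
open import Data.Vec as Vec using ([]; _∷_)
import Data.Vec.Functional as Vector
open import Data.Vec.Properties as Vecₚ using ()
open import Function using (_∘_; flip; id)
open import Function.Definitions using (Injective)
open import Level using (0ℓ)
open import Relation.Binary using (Rel; Reflexive; Transitive; Decidable; DecidableEquality)
open import Relation.Binary.Definitions using (tri<; tri≈; tri>)
open import Relation.Binary.PropositionalEquality
  using (_≡_; _≢_; refl; sym; trans; cong; cong₂; subst; subst₂; module ≡-Reasoning)
open import Relation.Nullary
  using (¬_; Dec; yes; no; ¬?; _×-dec_; _⊎-dec_; contradiction; map′; decidable-stable)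
import Relation.Unary as U

-- Antichains, chain partitions and Dilworth's theorem.

injective⇒hits : ∀ {m} {f : Fin m → Fin m} → Injective _≡_ _≡_ f →
                 ∀ j → ∃ λ i → f i ≡ j
injective⇒hits {suc m} {f} f-inj j with Finₚ.any? (λ i → f i Fin.≟ j)
... | yes hit = hit
... | no miss = contradiction
        (injective⇒≤ {f = λ i → punchOut (λ j≡fi → miss (i , sym j≡fi))}
          (f-inj ∘ punchOut-injective (λ j≡fi → miss (_ , sym j≡fi)) (λ j≡fi → miss (_ , sym j≡fi))))
        ℕₚ.1+n≰n

module Dilworth {A : Set} {_≤_ : Rel A 0ℓ}
  (≤-refl : Reflexive _≤_) (≤-trans : Transitive _≤_) (_≤?_ : Decidable _≤_) where

  Comparable : Rel A 0ℓ
  Comparable x y = x ≤ y ⊎ y ≤ x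

  comparable? : Decidable Comparable
  comparable? x y = (x ≤? y) ⊎-dec (y ≤? x)

  -- The single implication covers both pairwise incomparability and, through reflexivity,
  -- injectivity of `f`.
  Antichain : ℕ → List A → Set
  Antichain k xs = Σ (Fin k → A) λ f → (∀ i → f i ∈ xs) × (∀ i j → f i ≤ f j → i ≡ j)

  antichain-⊆ : ∀ {k xs ys} → (∀ {x} → x ∈ xs → x ∈ ys) → Antichain k xs → Antichain k ys
  antichain-⊆ xs⊆ys (f , f∈ , f-anti) = f , xs⊆ys ∘ f∈ , f-anti

  antichain-≤ : ∀ {j k xs} → j ℕ.≤ k → Antichain k xs → Antichain j xs
  antichain-≤ j≤k (f , f∈ , f-anti) =
    (λ i → f (inject≤ i j≤k)) , (λ i → f∈ _) ,
    λ i j fi≤fj → inject≤-injective j≤k j≤k i j (f-anti _ _ fi≤fj)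

  incomparableTo : A → List A → List A
  incomparableTo x = filter (λ y → ¬? (comparable? x y))

  antichain-∷ : ∀ {k x xs} → x ∈ xs → Antichain k (incomparableTo x xs) → Antichain (suc k) xs
  antichain-∷ {k} {x} {xs} x∈xs (f , f∈ , f-anti) = g , g∈ , g-anti
    where
    f∈′ : ∀ i → f i ∈ xs × ¬ Comparable x (f i)
    f∈′ i = ∈-filter⁻ (λ y → ¬? (comparable? x y)) (f∈ i)

    g : Fin (suc k) → A
    g = x Vector.∷ f

    g∈ : ∀ i → g i ∈ xs
    g∈ zero    = x∈xs
    g∈ (suc i) = proj₁ (f∈′ i)

    g-anti : ∀ i j → g i ≤ g j → i ≡ j
    g-anti zero    zero    _     = refl
    g-anti zero    (suc j) x≤fj  = contradiction (inj₁ x≤fj) (proj₂ (f∈′ j))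
    g-anti (suc i) zero    fi≤x  = contradiction (inj₂ fi≤x) (proj₂ (f∈′ i))
    g-anti (suc i) (suc j) fi≤fj = cong suc (f-anti i j fi≤fj)

  -- Converse of `antichain-∷`. Together they trade an antichain through a point for a smaller one
  -- among the elements incomparable to it, so the existence of antichains is decided by recursion
  -- on the size.
  antichain-remove : ∀ {k xs} ((f , _) : Antichain (suc k) xs) i →
                     Antichain k (incomparableTo (f i) xs)
  antichain-remove (f , f∈ , f-anti) i =
    f ∘ punchIn i ,
    (λ j → ∈-filter⁺ (λ y → ¬? (comparable? (f i) y)) (f∈ _)
      λ { (inj₁ fi≤) → punchInᵢ≢i i j (sym (f-anti _ _ fi≤))
        ; (inj₂ ≤fi) → punchInᵢ≢i i j (f-anti _ _ ≤fi) }) ,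
    λ j l fj≤fl → punchIn-injective i j l (f-anti _ _ fj≤fl)

  antichain? : ∀ k xs → Dec (Antichain k xs)
  antichain? zero    xs = yes ((λ ()) , (λ ()) , λ ())
  antichain? (suc k) xs = map′
    (λ any → let x , x∈xs , ac = find any in antichain-∷ x∈xs ac)
    (λ ac@(_ , f∈ , _) → lose (f∈ zero) (antichain-remove ac zero))
    (Any.any? (λ x → antichain? k (incomparableTo x xs)) xs)

  -- A partition into k chains, given by the indices of the chains.
  Colouring : ℕ → List A → Set
  Colouring k xs = Σ (A → ℕ) λ c →
    (∀ {x} → x ∈ xs → c x < k) ×
    (∀ {x y} → x ∈ xs → y ∈ xs → c x ≡ c y → Comparable x y)

  colouring-≤ : ∀ {j k xs} → j ℕ.≤ k → Colouring j xs → Colouring k xs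
  colouring-≤ j≤k (c , c< , c-chain) = c , (λ x∈ → ℕₚ.≤-trans (c< x∈) j≤k) , c-chain

  -- Two members of an antichain cannot lie on one chain, so `k` members carry `k` distinct colours
  -- out of `k`.
  colour-hit : ∀ {k xs} ((c , _) : Colouring k xs) ((f , _) : Antichain k xs) →
               ∀ (i : Fin k) → ∃ λ j → c (f j) ≡ toℕ i
  colour-hit (c , c< , c-chain) (f , f∈ , f-anti) i =
    let j , cfj≡i = injective⇒hits {f = λ j → fromℕ< (c< (f∈ j))}
                      (λ eq → injective (fromℕ<-injective _ _ _ _ eq)) i
    in  j , trans (sym (toℕ-fromℕ< _)) (cong toℕ cfj≡i)
    where
    injective : ∀ {j l} → c (f j) ≡ c (f l) → j ≡ l
    injective {j} {l} eq with c-chain (f∈ j) (f∈ l) eq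
    ... | inj₁ fj≤fl = f-anti j l fj≤fl
    ... | inj₂ fl≤fj = sym (f-anti l j fl≤fj)

  colouring-extend : ∀ {k xs} {K : U.Pred A 0ℓ} (K? : U.Decidable K) →
    (∀ {x y} → x ∈ xs → y ∈ xs → K x → K y → Comparable x y) →
    Colouring k (filter (¬? ∘ K?) xs) → Colouring (suc k) xs
  colouring-extend {k} {xs} K? K-chain (c , c< , c-chain) = c′ , c′< , c′-chain
    where
    c′ : A → ℕ
    c′ x with K? x
    ... | yes _ = k
    ... | no  _ = c x

    c′< : ∀ {x} → x ∈ xs → c′ x < suc k
    c′< {x} x∈ with K? x
    ... | yes _  = ℕₚ.≤-refl
    ... | no ¬Kx = ℕₚ.m<n⇒m<1+n (c< (∈-filter⁺ (¬? ∘ K?) x∈ ¬Kx))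

    c′-chain : ∀ {x y} → x ∈ xs → y ∈ xs → c′ x ≡ c′ y → Comparable x y
    c′-chain {x} {y} x∈ y∈ eq with K? x | K? y
    ... | yes Kx | yes Ky = K-chain x∈ y∈ Kx Ky
    ... | yes _  | no ¬Ky = contradiction (sym eq) (ℕₚ.<⇒≢ (c< (∈-filter⁺ (¬? ∘ K?) y∈ ¬Ky)))
    ... | no ¬Kx | yes _  = contradiction eq (ℕₚ.<⇒≢ (c< (∈-filter⁺ (¬? ∘ K?) x∈ ¬Kx)))
    ... | no ¬Kx | no ¬Ky =
      c-chain (∈-filter⁺ (¬? ∘ K?) x∈ ¬Kx) (∈-filter⁺ (¬? ∘ K?) y∈ ¬Ky) eq

  -- The order is only a preorder here, so maximality is expressed by `y ≤ x` instead of equality;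
  -- `z` witnesses that the list is not empty.
  maximal : ∀ {z xs} → z ∈ xs → ∃ λ x → x ∈ xs × (∀ {y} → y ∈ xs → x ≤ y → y ≤ x)
  maximal {xs = x ∷ []}     _ = x , here refl , λ { (here refl) x≤x → x≤x }
  maximal {xs = x ∷ y ∷ ys} _ with maximal {xs = y ∷ ys} (here refl)
  ... | m , m∈ , m-max with m ≤? x
  ...   | yes m≤x = x , here refl , λ
          { (here refl) x≤x → x≤x
          ; (there z∈) x≤z → ≤-trans (m-max z∈ (≤-trans m≤x x≤z)) m≤x }
  ...   | no m≰x = m , there m∈ , λ
          { (here refl) m≤x → contradiction m≤x m≰x
          ; (there z∈) m≤z → m-max z∈ m≤z }

  record Peak {k : ℕ} {xs : List A} (C : Colouring k xs) (i : Fin k) : Set where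
    field
      point     : A
      point∈    : point ∈ xs
      coloured  : proj₁ C point ≡ toℕ i
      through   : Σ (Antichain k xs) λ (f , _) → ∃ λ t → f t ≡ point
      highest   : ∀ ((f , _) : Antichain k xs) t → proj₁ C (f t) ≡ toℕ i → f t ≤ point

  open Peak

  -- Lying on a largest antichain is decidable, so the candidates of colour `i` form a filtered
  -- list, which is not empty because the given antichain meets every colour. A maximal candidate is
  -- highest since all candidates lie on one chain.
  peak : ∀ {k xs} (C : Colouring k xs) → Antichain k xs → ∀ i → Peak C i
  peak {suc k} {xs} C@(c , _ , c-chain) F@(f , f∈ , _) i = record
    { point = proj₁ top ; point∈ = proj₁ top∈ ; coloured = proj₁ (proj₂ top∈)
    ; through = antichain-∷ (proj₁ top∈) (proj₂ (proj₂ top∈)) , zero , refl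
    ; highest = λ G t → highest′ G t }
    where
    class? : ∀ x → Dec (c x ≡ toℕ i × Antichain k (incomparableTo x xs))
    class? x = (c x ℕ.≟ toℕ i) ×-dec antichain? k (incomparableTo x xs)

    class∋ : ∀ ((g , _) : Antichain (suc k) xs) t → c (g t) ≡ toℕ i → g t ∈ filter class? xs
    class∋ G@(_ , g∈ , _) t eq = ∈-filter⁺ class? (g∈ t) (eq , antichain-remove G t)

    top : ∃ λ x → x ∈ filter class? xs × (∀ {y} → y ∈ filter class? xs → x ≤ y → y ≤ x)
    top = let s , eq = colour-hit C F i in maximal (class∋ F s eq)

    top∈ = ∈-filter⁻ class? (proj₁ (proj₂ top))

    highest′ : ∀ ((g , _) : Antichain (suc k) xs) t → c (g t) ≡ toℕ i → g t ≤ proj₁ top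
    highest′ G@(_ , g∈ , _) t eq
      with c-chain (g∈ t) (proj₁ top∈) (trans eq (sym (proj₁ (proj₂ top∈))))
    ... | inj₁ gt≤ = gt≤
    ... | inj₂ ≤gt = proj₂ (proj₂ top) (class∋ G t eq) ≤gt

  -- Suppose peak `i` lies below peak `j`. The antichain through peak `j` has a member of colour
  -- `i`; it is at most peak `i`, hence at most peak `j`, hence is peak `j`, and the colours agree.
  peaks-antichain : ∀ {k xs} (C : Colouring k xs) (p : ∀ i → Peak C i) →
                    ∀ i j → point (p i) ≤ point (p j) → i ≡ j
  peaks-antichain C@(c , _) p i j pi≤pj
    with through (p j)
  ... | G@(g , _ , g-anti) , t , gt≡pj with colour-hit C G i
  ...   | s , cgs≡i = toℕ-injective
            (trans (sym cgs≡i) (trans (cong (c ∘ g) s≡t) (trans (cong c gt≡pj) (coloured (p j)))))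
    where
    s≡t : s ≡ t
    s≡t = g-anti s t (≤-trans (highest (p i) G s cgs≡i) (subst (point (p i) ≤_) (sym gt≡pj) pi≤pj))

  -- Galvin's proof: remove a maximal element a, and look at the highest point of each
  -- chain lying on a largest antichain of the rest.
  dilworth : ∀ xs → ∃ λ k → Colouring k xs × Antichain k xs
  dilworth xs = go xs (<-wellFounded (length xs))
    where
    go : ∀ xs → Acc _<_ (length xs) → ∃ λ k → Colouring k xs × Antichain k xs
    go [] _ = 0 , ((λ _ → 0) , (λ ()) , λ ()) , (λ ()) , (λ ()) , λ ()
    go xs@(_ ∷ _) (acc rec) with maximal {xs = xs} (here refl)
    ... | a , a∈ , a-max = result
      where
      -- All elements above `a` are removed together with `a`: by maximality they are equivalent to
      -- it, so they form a chain.
      below? : ∀ x → Dec (¬ (a ≤ x))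
      below? x = ¬? (a ≤? x)

      rest : List A
      rest = filter below? xs

      rest-shrinks : ∀ {Q : U.Pred A 0ℓ} (Q? : U.Decidable Q) → Q a →
                     length (filter (¬? ∘ Q?) xs) < length xs
      rest-shrinks Q? Qa = filter-notAll (¬? ∘ Q?) xs (lose a∈ (λ ¬Qa → ¬Qa Qa))

      rest⊆ : ∀ {x} → x ∈ rest → x ∈ xs
      rest⊆ = proj₁ ∘ ∈-filter⁻ below?

      above : ∀ {x y} → x ∈ xs → a ≤ x → a ≤ y → x ≤ y
      above x∈ a≤x a≤y = ≤-trans (a-max x∈ a≤x) a≤y

      result : ∃ λ k → Colouring k xs × Antichain k xs
      result with go rest (rec (rest-shrinks (a ≤?_) ≤-refl))
      ... | k , C@(c , c< , c-chain) , F = dichotomy (Finₚ.any? (λ i → point (p i) ≤? a))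
        where
        p : ∀ i → Peak C i
        p = peak C F

        dichotomy : Dec (∃ λ i → point (p i) ≤ a) → ∃ λ k → Colouring k xs × Antichain k xs
        -- No peak is below `a`, and no peak is above it since peaks lie in `rest`. So `a` enlarges
        -- the antichain of peaks, while the elements above `a` receive a new colour.
        dichotomy (no none) =
          suc k ,
          colouring-extend (a ≤?_) (λ x∈ _ a≤x a≤y → inj₁ (above x∈ a≤x a≤y)) C ,
          antichain-∷ a∈ (point ∘ p ,
            (λ i → ∈-filter⁺ (λ y → ¬? (comparable? a y)) (rest⊆ (point∈ (p i))) λ
              { (inj₁ a≤pi) → proj₂ (∈-filter⁻ below? {xs = xs} (point∈ (p i))) a≤pi
              ; (inj₂ pi≤a) → none (i , pi≤a) }) ,
            peaks-antichain C p)
        -- The elements above `a` and the part of chain `i` up to its peak form one chain `K`. An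
        -- antichain of size `k` outside `K` would have a member of colour `i`, at or below the peak
        -- and thus in `K`. So fewer than `k` colours suffice outside `K`, and `K` takes one more.
        dichotomy (yes (i , pi≤a)) =
          let k′ , C′ , F′ = go (filter (¬? ∘ K?) xs) (rec (rest-shrinks K? (inj₁ ≤-refl)))
          in  k , colouring-≤ (k′<k F′) (colouring-extend K? K-chain C′) ,
              point ∘ p , rest⊆ ∘ point∈ ∘ p , peaks-antichain C p
          where
          K : U.Pred A 0ℓ
          K x = a ≤ x ⊎ (c x ≡ toℕ i × x ≤ point (p i))

          K? : U.Decidable K
          K? x = (a ≤? x) ⊎-dec ((c x ℕ.≟ toℕ i) ×-dec (x ≤? point (p i)))

          -- The colouring `C` says nothing about elements above `a`, so the first alternative takes
          -- precedence.
          K-cases : ∀ {x} → x ∈ xs → K x → a ≤ x ⊎ (x ∈ rest × c x ≡ toℕ i × x ≤ point (p i))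
          K-cases {x} x∈ (inj₁ a≤x) = inj₁ a≤x
          K-cases {x} x∈ (inj₂ x-in) with a ≤? x
          ... | yes a≤x = inj₁ a≤x
          ... | no a≰x  = inj₂ (∈-filter⁺ below? x∈ a≰x , x-in)

          K-chain : ∀ {x y} → x ∈ xs → y ∈ xs → K x → K y → Comparable x y
          K-chain x∈ y∈ Kx Ky with K-cases x∈ Kx | K-cases y∈ Ky
          ... | inj₁ a≤x | inj₁ a≤y = inj₁ (above x∈ a≤x a≤y)
          ... | inj₁ a≤x | inj₂ (_ , _ , y≤) = inj₂ (≤-trans y≤ (≤-trans pi≤a a≤x))
          ... | inj₂ (_ , _ , x≤) | inj₁ a≤y = inj₁ (≤-trans x≤ (≤-trans pi≤a a≤y))
          ... | inj₂ (x∈′ , cx , _) | inj₂ (y∈′ , cy , _) = c-chain x∈′ y∈′ (trans cx (sym cy))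

          left⊆rest : ∀ {x} → x ∈ filter (¬? ∘ K?) xs → x ∈ rest
          left⊆rest x∈ = let x∈xs , ¬Kx = ∈-filter⁻ (¬? ∘ K?) x∈ in ∈-filter⁺ below? x∈xs (¬Kx ∘ inj₁)

          k′<k : ∀ {k′} → Antichain k′ (filter (¬? ∘ K?) xs) → k′ < k
          k′<k {k′} F′ with k′ ℕ.<? k
          ... | yes lt = lt
          ... | no k′≮k = contradiction (inj₂ (cgs , highest (p i) G s cgs))
                            (proj₂ (∈-filter⁻ (¬? ∘ K?) {xs = xs} (proj₁ (proj₂ G′) s)))
            where
            G′ = antichain-≤ (ℕₚ.≮⇒≥ k′≮k) F′
            G = antichain-⊆ left⊆rest G′
            s = proj₁ (colour-hit C G i)
            cgs = proj₂ (colour-hit C G i)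

-- Antichains of subsets, cardinalities and exchanges.

module _ {n : ℕ} where
  open Dilworth {Subset n} {_⊆_} ⊆-refl ⊆-trans _⊆?_ public
  -- Reversing inclusion turns maximal elements into minimal ones.
  open Dilworth {Subset n} {flip _⊆_} ⊆-refl (flip ⊆-trans) (flip _⊆?_) public
    using () renaming (maximal to minimal)

_≟ˢ_ : ∀ {n} → DecidableEquality (Subset n)
_≟ˢ_ = Vecₚ.≡-dec Boolₚ._≟_

_∈F?_ : ∀ {n} (S : Subset n) xs → Dec (S ∈ xs)
_∈F?_ = DecMembership._∈?_ _≟ˢ_

contained⇒antichain : ∀ {n k} (F : Family n) → ContainsInduced (antichain k) F → Antichain k (members F)
contained⇒antichain _ (f , _ , f∈ , f-iso) = f , f∈ , λ i j → proj₂ (f-iso i j)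

antichain⇒contained : ∀ {n k} (F : Family n) → Antichain k (members F) → ContainsInduced (antichain k) F
antichain⇒contained _ (f , f∈ , f-anti) =
  f , (λ eq → f-anti _ _ (⊆-reflexive eq)) , f∈ , λ i j → (λ { refl → ⊆-refl }) , f-anti i j

⊈⇒∃ : ∀ {n} {p q : Subset n} → ¬ (p ⊆ q) → ∃ λ x → x ∈ˢ p × x ∉ˢ q
⊈⇒∃ {p = p} {q} p⊈q with Finₚ.any? (λ x → (x ∈ˢ? p) ×-dec ¬? (x ∈ˢ? q))
... | yes found = found
... | no none = contradiction (λ {x} x∈p → decidable-stable (x ∈ˢ? q) (λ x∉q → none (x , x∈p , x∉q))) p⊈q

⊆∧∣≤∣⇒≡ : ∀ {n} {p q : Subset n} → p ⊆ q → ∣ q ∣ ≤ ∣ p ∣ → p ≡ q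
⊆∧∣≤∣⇒≡ {p = p} {q} p⊆q ∣q∣≤∣p∣ with q ⊆? p
... | yes q⊆p = ⊆-antisym p⊆q q⊆p
... | no q⊈p  = contradiction ∣q∣≤∣p∣ (<⇒≱ (p⊂q⇒∣p∣<∣q∣ ((λ {x} → p⊆q {x}) , ⊈⇒∃ q⊈p)))

comparable⇒≡ : ∀ {n} {p q : Subset n} → Comparable p q → ∣ p ∣ ≡ ∣ q ∣ → p ≡ q
comparable⇒≡ (inj₁ p⊆q) eq = ⊆∧∣≤∣⇒≡ p⊆q (≤-reflexive (sym eq))
comparable⇒≡ (inj₂ q⊆p) eq = sym (⊆∧∣≤∣⇒≡ q⊆p (≤-reflexive eq))

∣p∪⁅x⁆∣ : ∀ {n} {x} {p : Subset n} → x ∉ˢ p → ∣ p ∪ ⁅ x ⁆ ∣ ≡ suc ∣ p ∣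
∣p∪⁅x⁆∣ {x = zero}  {inside  ∷ p} x∉p = contradiction Vec.here x∉p
∣p∪⁅x⁆∣ {x = zero}  {outside ∷ p} x∉p = cong (suc ∘ ∣_∣) (∪-identityʳ p)
∣p∪⁅x⁆∣ {x = suc x} {inside  ∷ p} x∉p = cong suc (∣p∪⁅x⁆∣ (x∉p ∘ Vec.there))
∣p∪⁅x⁆∣ {x = suc x} {outside ∷ p} x∉p = ∣p∪⁅x⁆∣ (x∉p ∘ Vec.there)

∣p-x∣ : ∀ {n} {x} {p : Subset n} → x ∈ˢ p → suc ∣ p - x ∣ ≡ ∣ p ∣
∣p-x∣ {x = zero}  {inside  ∷ p} Vec.here        = cong (suc ∘ ∣_∣) (p─⊥≡p p)
∣p-x∣ {x = suc x} {inside  ∷ p} (Vec.there x∈p) = cong suc (∣p-x∣ x∈p)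
∣p-x∣ {x = suc x} {outside ∷ p} (Vec.there x∈p) = ∣p-x∣ x∈p

x∉p-x : ∀ {n} (x : Fin n) p → x ∉ˢ p - x
x∉p-x zero    (inside  ∷ p) ()
x∉p-x zero    (outside ∷ p) ()
x∉p-x (suc x) (s ∷ p) (Vec.there x∈) = x∉p-x x p x∈

exchange : ∀ {n} → Subset n → Fin n → Fin n → Subset n
exchange p u v = (p - u) ∪ ⁅ v ⁆

module _ {n} {p : Subset n} {u v : Fin n} where

  ∈-exchange : v ∈ˢ exchange p u v
  ∈-exchange = x∈p∪q⁺ (inj₂ (x∈⁅x⁆ v))

  ∈-exchange⁺ : ∀ {x} → x ∈ˢ p → x ≢ u → x ∈ˢ exchange p u v
  ∈-exchange⁺ x∈p x≢u = x∈p∪q⁺ (inj₁ (x∈p∧x≢y⇒x∈p-y x∈p x≢u))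

  ∈-exchange⁻ : ∀ {x} → x ∈ˢ exchange p u v → x ∈ˢ p ⊎ x ≡ v
  ∈-exchange⁻ x∈ with x∈p∪q⁻ (p - u) ⁅ v ⁆ x∈
  ... | inj₁ x∈p-u = inj₁ (p─q⊆p p ⁅ u ⁆ x∈p-u)
  ... | inj₂ x∈⁅v⁆ = inj₂ (x∈⁅y⁆⇒x≡y v x∈⁅v⁆)

  ∉-exchange : u ≢ v → u ∉ˢ exchange p u v
  ∉-exchange u≢v u∈ with x∈p∪q⁻ (p - u) ⁅ v ⁆ u∈
  ... | inj₁ u∈p-u = x∉p-x u p u∈p-u
  ... | inj₂ u∈⁅v⁆ = u≢v (x∈⁅y⁆⇒x≡y v u∈⁅v⁆)

  ∣exchange∣ : u ∈ˢ p → v ∉ˢ p → ∣ exchange p u v ∣ ≡ ∣ p ∣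
  ∣exchange∣ u∈p v∉p = trans (∣p∪⁅x⁆∣ (v∉p ∘ p─q⊆p p ⁅ u ⁆)) (∣p-x∣ u∈p)

-- Levels of a family.

lookup-unique : ∀ {A : Set} {xs : List A} → Unique xs → ∀ {i j} → lookup xs i ≡ lookup xs j → i ≡ j
lookup-unique (_    ∷ _) {zero}  {zero}  _  = refl
lookup-unique (x∉xs ∷ _) {zero}  {suc j} eq = contradiction eq (All.lookup x∉xs (∈-lookup j))
lookup-unique (x∉xs ∷ _) {suc i} {zero}  eq = contradiction (sym eq) (All.lookup x∉xs (∈-lookup i))
lookup-unique (_    ∷ u) {suc i} {suc j} eq = cong suc (lookup-unique u eq)

unique-∷ : ∀ {A : Set} {x : A} {xs} → x ∉ xs → Unique xs → Unique (x ∷ xs)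
unique-∷ x∉xs u = ¬Any⇒All¬ _ x∉xs ∷ u

level : ∀ {n} → ℕ → List (Subset n) → List (Subset n)
level m = filter (λ S → ∣ S ∣ ℕ.≟ m)

below : ∀ {n} → ℕ → List (Subset n) → List (Subset n)
below m = filter (λ S → ∣ S ∣ ℕ.<? m)

length-filter-⊎ : ∀ {A : Set} {P Q R : U.Pred A 0ℓ}
  (P? : U.Decidable P) (Q? : U.Decidable Q) (R? : U.Decidable R) →
  (∀ {x} → P x → Q x ⊎ R x) → (∀ {x} → Q x → P x) → (∀ {x} → R x → P x) → (∀ {x} → Q x → ¬ R x) →
  ∀ xs → length (filter P? xs) ≡ length (filter Q? xs) + length (filter R? xs)
length-filter-⊎ P? Q? R? split left right disjoint = go
  where
  go : ∀ xs → length (filter P? xs) ≡ length (filter Q? xs) + length (filter R? xs)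
  go [] = refl
  go (x ∷ xs) with P? x | Q? x | R? x
  ... | yes _ | yes _ | no _  = cong suc (go xs)
  ... | yes _ | no _  | yes _ = trans (cong suc (go xs)) (sym (+-suc _ _))
  ... | no _  | no _  | no _  = go xs
  ... | _     | yes q | yes r = contradiction r (disjoint q)
  ... | yes p | no ¬q | no ¬r = contradiction (split p) [ ¬q , ¬r ]′
  ... | no ¬p | yes q | no _  = contradiction (left q) ¬p
  ... | no ¬p | no _  | yes r = contradiction (right r) ¬p

length-below : ∀ {n} m (xs : List (Subset n)) →
               length (below (suc m) xs) ≡ length (below m xs) + length (level m xs)
length-below m = length-filter-⊎ _ _ _ m<1+n⇒m<n∨m≡n m<n⇒m<1+n (λ { refl → n<1+n m }) <⇒≢

-- Inclusion between sets of equal size is equality, and the entries are distinct.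
level-antichain : ∀ {n} m {xs : List (Subset n)} → Unique xs → Antichain (length (level m xs)) xs
level-antichain m {xs} u = lookup (level m xs) , proj₁ ∘ in-level , anti
  where
  in-level : ∀ i → lookup (level m xs) i ∈ xs × ∣ lookup (level m xs) i ∣ ≡ m
  in-level i = ∈-filter⁻ (λ S → ∣ S ∣ ℕ.≟ m) (∈-lookup i)

  anti : ∀ i j → lookup (level m xs) i ⊆ lookup (level m xs) j → i ≡ j
  anti i j Si⊆Sj = lookup-unique (Uniqueₚ.filter⁺ (λ S → ∣ S ∣ ℕ.≟ m) u)
    (⊆∧∣≤∣⇒≡ Si⊆Sj (≤-reflexive (trans (proj₂ (in-level j)) (sym (proj₂ (in-level i))))))

length-level-≤ : ∀ {n k} m {xs : List (Subset n)} → Unique xs → ¬ Antichain (suc k) xs →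
                 length (level m xs) ≤ k
length-level-≤ m u none = ≮⇒≥ λ k< → none (antichain-≤ k< (level-antichain m u))

-- Saturated families: greedy construction and obstructions.

subsets : ∀ n → List (Subset n)
subsets zero    = [] ∷ []
subsets (suc n) = map (outside ∷_) (subsets n) ++ map (inside ∷_) (subsets n)

∈-subsets : ∀ {n} (S : Subset n) → S ∈ subsets n
∈-subsets []            = here refl
∈-subsets (outside ∷ S) = ∈-++⁺ˡ (∈-map⁺ (outside ∷_) (∈-subsets S))
∈-subsets (inside  ∷ S) = ∈-++⁺ʳ (map (outside ∷_) (subsets _)) (∈-map⁺ (inside ∷_) (∈-subsets S))

-- Each candidate in `us` is added unless it would create an antichain of size `suc k`. A rejected
-- set stays blocked, because the antichain that blocks it survives as the list grows.
greedy : ∀ {n} k us (xs : List (Subset n)) → Unique xs → ¬ Antichain (suc k) xs →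
         ∃ λ ys → Unique ys × ¬ Antichain (suc k) ys × (∀ {S} → S ∈ xs → S ∈ ys) ×
                  (∀ {S} → S ∈ us → S ∉ ys → Antichain (suc k) (S ∷ ys))
greedy k [] xs u none = xs , u , none , id , λ ()
greedy k (U ∷ us) xs u none with U ∈F? xs
... | yes U∈xs = let ys , u′ , none′ , xs⊆ys , maximal = greedy k us xs u none in
      ys , u′ , none′ , xs⊆ys , λ
      { (here refl) U∉ys → contradiction (xs⊆ys U∈xs) U∉ys
      ; (there S∈us) → maximal S∈us }
... | no U∉xs with antichain? (suc k) (U ∷ xs)
...   | yes ac = let ys , u′ , none′ , xs⊆ys , maximal = greedy k us xs u none in
        ys , u′ , none′ , xs⊆ys , λ
        { (here refl) _ → antichain-⊆ (λ { (here eq) → here eq ; (there S∈xs) → there (xs⊆ys S∈xs) }) ac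
        ; (there S∈us) → maximal S∈us }
...   | no ¬ac = let ys , u′ , none′ , xs⊆ys , maximal = greedy k us (U ∷ xs) (unique-∷ U∉xs u) ¬ac in
        ys , u′ , none′ , xs⊆ys ∘ there , λ
        { (here refl) U∉ys → contradiction (xs⊆ys (here refl)) U∉ys
        ; (there S∈us) → maximal S∈us }

-- The candidates are all subsets. A strictly larger family contains some new `S` along with the old
-- sets, and this one set already creates the antichain.
saturate : ∀ {n} k (xs : List (Subset n)) → Unique xs → ¬ Antichain (suc k) xs →
           ∃ λ F → IsInducedSaturated n (antichain (suc k)) F × (∀ {S} → S ∈ xs → S ∈F F)
saturate k xs u none =
  let ys , u′ , none′ , xs⊆ys , maximal = greedy k (subsets _) xs u none in
  family ys u′ ,
  (none′ ∘ contained⇒antichain (family ys u′) ,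
   λ F' (F⊆F' , S , S∈F' , S∉F) → antichain⇒contained F'
     (antichain-⊆ (λ { (here refl) → S∈F' ; (there T∈F) → F⊆F' T∈F }) (maximal (∈-subsets S) S∉F))) ,
  xs⊆ys

module Saturated {n k} (F : Family n) (sat : IsInducedSaturated n (antichain (suc k)) F) where

  no-antichain : ¬ Antichain (suc k) (members F)
  no-antichain = proj₁ sat ∘ antichain⇒contained F

  abstract
    -- Adding `Z` creates an antichain of size `suc k`. It must use `Z`, since `F` contains none,
    -- and its other `k` members are incomparable to `Z`.
    obstruction : ∀ {Z} → Z ∉ members F → Antichain k (incomparableTo Z (members F))
    obstruction {Z} Z∉F = without-Z (contained⇒antichain F⁺ (proj₂ sat F⁺ (there , Z , here refl , Z∉F)))
      where
      F⁺ : Family n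
      F⁺ = family (Z ∷ members F) (unique-∷ Z∉F (unique F))

      incomparable? : ∀ S → Dec (¬ Comparable Z S)
      incomparable? S = ¬? (comparable? Z S)

      drop : ∀ {S} → S ≢ Z → S ∈ Z ∷ members F → S ∈ members F
      drop S≢Z (here S≡Z)  = contradiction S≡Z S≢Z
      drop S≢Z (there S∈F) = S∈F

      drop′ : ∀ {S} → S ∈ incomparableTo Z (Z ∷ members F) → S ∈ incomparableTo Z (members F)
      drop′ S∈ with ∈-filter⁻ incomparable? {xs = Z ∷ members F} S∈
      ... | here refl , ∥ = ⊥-elim (∥ (inj₁ ⊆-refl))
      ... | there S∈F , ∥ = ∈-filter⁺ incomparable? S∈F ∥

      without-Z : Antichain (suc k) (Z ∷ members F) → Antichain k (incomparableTo Z (members F))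
      without-Z G@(g , g∈ , g-anti) with Finₚ.any? (λ i → g i ≟ˢ Z)
      ... | no none = contradiction (g , (λ i → drop (none ∘ (i ,_)) (g∈ i)) , g-anti) no-antichain
      ... | yes (i , refl) = antichain-⊆ drop′ (antichain-remove G i)

-- Full chains and extending a chain of sets to one.

-- Levels range over all of `ℕ`; beyond `n` the inclusions force `at` to stay at the full set.
record FullChain (n : ℕ) : Set where
  field
    at   : ℕ → Subset n
    size : ∀ {m} → m ≤ n → ∣ at m ∣ ≡ m
    step : ∀ m → at m ⊆ at (suc m)

  at-mono : ∀ {l m} → l ≤ m → at l ⊆ at m
  at-mono {l} {m} l≤m = go (ℕₚ.≤⇒≤′ l≤m)
    where
    go : ∀ {m} → l ℕ.≤′ m → at l ⊆ at m
    go (ℕ.≤′-reflexive refl) = ⊆-refl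
    go {suc m} (ℕ.≤′-step l≤m) = ⊆-trans (go l≤m) (step m)

  at-comparable : ∀ l m → Comparable (at l) (at m)
  at-comparable l m with ≤-total l m
  ... | inj₁ l≤m = inj₁ (at-mono l≤m)
  ... | inj₂ m≤l = inj₂ (at-mono m≤l)

open FullChain

module _ {n} (xs : List (Subset n)) (chain : ∀ {S T} → S ∈ xs → T ∈ xs → Comparable S T) where

  private
    Compatible : Subset n → Set
    Compatible S = ∀ {T} → T ∈ xs → Comparable S T

  -- The new element comes from the least member of `xs` not inside `S`. Every other member not
  -- inside `S` contains that one, hence the new element, so comparability is kept.
  grow : ∀ S → Compatible S → ∣ S ∣ < n →
         ∃ λ S′ → Compatible S′ × S ⊆ S′ × ∣ S′ ∣ ≡ suc ∣ S ∣
  grow S comp ∣S∣<n = S ∪ ⁅ e ⁆ , comp′ , p⊆p∪q ⁅ e ⁆ , ∣p∪⁅x⁆∣ e∉S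
    where
    above? : ∀ T → Dec (¬ T ⊆ S)
    above? T = ¬? (T ⊆? S)

    -- The full set stands in when all members of `xs` lie inside `S`; it is not inside `S` either,
    -- as `S` has fewer than `n` elements.
    candidates : List (Subset n)
    candidates = ⊤ ∷ filter above? xs

    next : ∃ λ T → T ∈ candidates × (∀ {T′} → T′ ∈ candidates → T′ ⊆ T → T ⊆ T′)
    next = minimal {xs = candidates} (here refl)

    next⊈S : ¬ proj₁ next ⊆ S
    next⊈S with proj₁ (proj₂ next)
    ... | here eq = λ T⊆S → <⇒≱ ∣S∣<n
          (subst (_≤ ∣ S ∣) (∣⊤∣≡n n) (p⊆q⇒∣p∣≤∣q∣ (subst (_⊆ S) eq T⊆S)))
    ... | there T∈ = proj₂ (∈-filter⁻ above? {xs = xs} T∈)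

    next-least : ∀ {T} → T ∈ xs → ¬ T ⊆ S → proj₁ next ⊆ T
    next-least {T} T∈ T⊈S with proj₁ (proj₂ next)
    ... | here eq = proj₂ (proj₂ next) (there (∈-filter⁺ above? T∈ T⊈S)) (subst (T ⊆_) (sym eq) ⊆⊤)
    ... | there next∈ with chain (proj₁ (∈-filter⁻ above? next∈)) T∈
    ...   | inj₁ next⊆T = next⊆T
    ...   | inj₂ T⊆next = proj₂ (proj₂ next) (there (∈-filter⁺ above? T∈ T⊈S)) T⊆next

    e : Fin n
    e = proj₁ (⊈⇒∃ next⊈S)

    e∉S : e ∉ˢ S
    e∉S = proj₂ (proj₂ (⊈⇒∃ next⊈S))

    comp′ : Compatible (S ∪ ⁅ e ⁆)
    comp′ {T} T∈ with T ⊆? S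
    ... | yes T⊆S = inj₂ (⊆-trans T⊆S (p⊆p∪q ⁅ e ⁆))
    ... | no T⊈S with comp T∈
    ...   | inj₂ T⊆S = contradiction (λ {x} → T⊆S {x}) T⊈S
    ...   | inj₁ S⊆T = inj₁ λ x∈ → [ S⊆T , (λ x∈⁅e⁆ →
              subst (_∈ˢ T) (sym (x∈⁅y⁆⇒x≡y e x∈⁅e⁆))
                (next-least T∈ T⊈S (proj₁ (proj₂ (⊈⇒∃ next⊈S))))) ]′ (x∈p∪q⁻ S ⁅ e ⁆ x∈)

  private
    build : ℕ → ∃ Compatible
    build zero = ⊥ , λ _ → inj₁ ⊥⊆
    build (suc m) with build m
    ... | S , comp with ∣ S ∣ ℕ.<? n
    ...   | yes ∣S∣<n = let S′ , comp′ , _ = grow S comp ∣S∣<n in S′ , comp′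
    ...   | no _ = S , comp

    build-size : ∀ m → m ≤ n → ∣ proj₁ (build m) ∣ ≡ m
    build-size zero    _   = ∣⊥∣≡0 n
    build-size (suc m) m<n with build m | build-size m (<⇒≤ m<n)
    ... | S , comp | ∣S∣≡m with ∣ S ∣ ℕ.<? n
    ...   | yes ∣S∣<n = let _ , _ , _ , ∣S′∣ = grow S comp ∣S∣<n in trans ∣S′∣ (cong suc ∣S∣≡m)
    ...   | no ∣S∣≮n = contradiction (subst (_< n) (sym ∣S∣≡m) m<n) ∣S∣≮n

    build-step : ∀ m → proj₁ (build m) ⊆ proj₁ (build (suc m))
    build-step m with build m
    ... | S , comp with ∣ S ∣ ℕ.<? n
    ...   | yes ∣S∣<n = let _ , _ , S⊆S′ , _ = grow S comp ∣S∣<n in S⊆S′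
    ...   | no _ = ⊆-refl

  abstract
    -- Growing from the empty set keeps every stage comparable to each `S` in `xs`; the stage of
    -- size `∣ S ∣` must then be `S` itself.
    fullChain : ∃ λ (G : FullChain n) → ∀ {S} → S ∈ xs → S ≡ at G ∣ S ∣
    fullChain = record { at = proj₁ ∘ build ; size = build-size _ ; step = build-step } , λ {S} S∈ →
      sym (comparable⇒≡ (proj₂ (build ∣ S ∣) S∈) (build-size ∣ S ∣ (∣p∣≤n S)))

-- Two full chains through a common set.

∈∉⇒≢ : ∀ {n} {p : Subset n} {x y} → x ∈ˢ p → y ∉ˢ p → x ≢ y
∈∉⇒≢ x∈p y∉p refl = y∉p x∈p

module _ {n} (G H : FullChain n) where

  across : ∀ {l m r} → at G m ≡ at H m → l ≤ m → m ≤ r → at G l ⊆ at H r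
  across eq l≤m m≤r = ⊆-trans (at-mono G l≤m) (subst (_⊆ at H _) (sym eq) (at-mono H m≤r))

  across′ : ∀ {l m r} → at G m ≡ at H m → l ≤ m → m ≤ r → at H l ⊆ at G r
  across′ eq l≤m m≤r = ⊆-trans (at-mono H l≤m) (subst (_⊆ at G _) eq (at-mono G m≤r))

  Incomparable : ℕ → ℕ → Set
  Incomparable r s = ¬ Comparable (at G r) (at H s)

  -- Whatever lies at or below the common set is contained in whatever lies at or above it, on
  -- either chain.
  incomparable-same-side : ∀ {m r s} → at G m ≡ at H m → Incomparable r s →
                           (r < m × s < m) ⊎ (m < r × m < s)
  incomparable-same-side {m} {r} {s} eq ∥ with <-cmp r m | <-cmp s m
  ... | tri< r<m _ _ | tri< s<m _ _ = inj₁ (r<m , s<m)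
  ... | tri> _ _ m<r | tri> _ _ m<s = inj₂ (m<r , m<s)
  ... | tri< r<m _ _ | tri≈ _ s≡m _ = ⊥-elim (∥ (inj₁ (across eq (<⇒≤ r<m) (≤-reflexive (sym s≡m)))))
  ... | tri< r<m _ _ | tri> _ _ m<s = ⊥-elim (∥ (inj₁ (across eq (<⇒≤ r<m) (<⇒≤ m<s))))
  ... | tri≈ _ r≡m _ | tri< s<m _ _ = ⊥-elim (∥ (inj₂ (across′ eq (<⇒≤ s<m) (≤-reflexive (sym r≡m)))))
  ... | tri≈ _ r≡m _ | tri≈ _ s≡m _ = ⊥-elim (∥ (inj₁ (across eq (≤-reflexive r≡m) (≤-reflexive (sym s≡m)))))
  ... | tri≈ _ r≡m _ | tri> _ _ m<s = ⊥-elim (∥ (inj₁ (across eq (≤-reflexive r≡m) (<⇒≤ m<s))))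
  ... | tri> _ _ m<r | tri< s<m _ _ = ⊥-elim (∥ (inj₂ (across′ eq (<⇒≤ s<m) (<⇒≤ m<r))))
  ... | tri> _ _ m<r | tri≈ _ s≡m _ = ⊥-elim (∥ (inj₂ (across′ eq (≤-reflexive s≡m) (<⇒≤ m<r))))

  differ : ∀ {m} → m ≤ n → at G m ≢ at H m →
           (∃ λ u → u ∈ˢ at G m × u ∉ˢ at H m) × (∃ λ v → v ∈ˢ at H m × v ∉ˢ at G m)
  differ m≤n G≢H =
    ⊈⇒∃ (λ G⊆H → G≢H (⊆∧∣≤∣⇒≡ G⊆H (≤-reflexive (trans (size H m≤n) (sym (size G m≤n)))))) ,
    ⊈⇒∃ (λ H⊆G → G≢H (sym (⊆∧∣≤∣⇒≡ H⊆G (≤-reflexive (trans (size G m≤n) (sym (size H m≤n)))))))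

  -- In every incomparable pair below level `m`, one set avoids `u` and so remains a subset of the
  -- common set after `u` is removed.
  Removable : ℕ → Fin n → Set
  Removable m u = u ∈ˢ at G m ×
    (∀ {r s} → r < m → s < m → Incomparable r s → u ∉ˢ at G r ⊎ u ∉ˢ at H s)

  -- The dual condition: in every incomparable pair above level `m`, one set contains the common set
  -- with `v` added.
  Addable : ℕ → Fin n → Set
  Addable m v = v ∉ˢ at G m ×
    (∀ {r s} → m < r → r ≤ n → m < s → s ≤ n → Incomparable r s → v ∈ˢ at G r ⊎ v ∈ˢ at H s)

  -- Descend to the last level below m at which the two chains differ.
  removable : ∀ m → m ≤ n → at G m ≡ at H m →
    (∀ {r s} → r < m → s < m → Comparable (at G r) (at H s)) ⊎
    (∃ λ u → ∃ λ v → u ≢ v × Removable m u × Removable m v)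
  removable zero _ _ = inj₁ λ ()
  removable (suc m) m<n eq with at G m ≟ˢ at H m
  -- At level `m` the chain `H` misses `u` and `G` misses `v`, hence so do all their lower sets,
  -- while the common set at `suc m` contains both.
  ... | no G≢H =
    let (u , u∈G , u∉H) , (v , v∈H , v∉G) = differ (<⇒≤ m<n) G≢H in
    inj₂ (u , v , ∈∉⇒≢ u∈G v∉G ,
      (step G m u∈G , λ _ s<1+m _ → inj₂ (u∉H ∘ at-mono H (≤-pred s<1+m))) ,
      (subst (v ∈ˢ_) (sym eq) (step H m v∈H) , λ r<1+m _ _ → inj₁ (v∉G ∘ at-mono G (≤-pred r<1+m))))
  ... | yes eq′ with removable m (<⇒≤ m<n) eq′
  ...   | inj₁ comp = inj₁ λ r<1+m s<1+m → decidable-stable (comparable? _ _) λ ∥ →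
            let r<m , s<m = lower r<1+m s<1+m ∥ in ∥ (comp r<m s<m)
    where
    lower : ∀ {r s} → r < suc m → s < suc m → Incomparable r s → r < m × s < m
    lower r<1+m s<1+m ∥ with incomparable-same-side eq′ ∥
    ... | inj₁ both = both
    ... | inj₂ (m<r , _) = contradiction (≤-pred r<1+m) (<⇒≱ m<r)
  ...   | inj₂ (u , v , u≢v , u-rem , v-rem) = inj₂ (u , v , u≢v , lift u-rem , lift v-rem)
    where
    lift : ∀ {u} → Removable m u → Removable (suc m) u
    lift (u∈G , keep) = step G m u∈G , λ r<1+m s<1+m ∥ →
      [ (λ (r<m , s<m) → keep r<m s<m ∥)
      , (λ (m<r , _) → contradiction (≤-pred r<1+m) (<⇒≱ m<r)) ]′ (incomparable-same-side eq′ ∥)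

  -- Mirror image of `removable`: the search goes upwards, and `d` counts the levels left up to `n`.
  addable : ∀ d m → m + d ≡ n → at G m ≡ at H m →
    (∀ {r s} → m < r → r ≤ n → m < s → s ≤ n → Comparable (at G r) (at H s)) ⊎
    (∃ λ u → ∃ λ v → u ≢ v × Addable m u × Addable m v)
  addable zero m m+0≡n _ = inj₁ λ m<r r≤n _ _ →
    contradiction (≤-trans r≤n (≤-reflexive (trans (sym m+0≡n) (+-identityʳ m)))) (<⇒≱ m<r)
  addable (suc d) m m+1+d≡n eq with at G (suc m) ≟ˢ at H (suc m)
  ... | no G≢H =
    let m+1≤n = ≤-trans (m≤m+n (suc m) d) (≤-reflexive (trans (sym (+-suc m d)) m+1+d≡n))
        (u , u∈G , u∉H) , (v , v∈H , v∉G) = differ m+1≤n G≢H in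
    inj₂ (u , v , ∈∉⇒≢ u∈G v∉G ,
      ((λ u∈Gm → u∉H (step H m (subst (u ∈ˢ_) eq u∈Gm))) , λ m<r _ _ _ _ → inj₁ (at-mono G m<r u∈G)) ,
      (v∉G ∘ step G m , λ _ _ m<s _ _ → inj₂ (at-mono H m<s v∈H)))
  ... | yes eq′ with addable d (suc m) (trans (sym (+-suc m d)) m+1+d≡n) eq′
  ...   | inj₁ comp = inj₁ λ m<r r≤n m<s s≤n → decidable-stable (comparable? _ _) λ ∥ →
            let m+1<r , m+1<s = raise m<r m<s ∥ in ∥ (comp m+1<r r≤n m+1<s s≤n)
    where
    raise : ∀ {r s} → m < r → m < s → Incomparable r s → suc m < r × suc m < s
    raise m<r m<s ∥ with incomparable-same-side eq′ ∥
    ... | inj₁ (r<1+m , _) = contradiction (≤-pred r<1+m) (<⇒≱ m<r)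
    ... | inj₂ both = both
  ...   | inj₂ (u , v , u≢v , u-add , v-add) = inj₂ (u , v , u≢v , lift u-add , lift v-add)
    where
    lift : ∀ {u} → Addable (suc m) u → Addable m u
    lift (u∉G , hit) = u∉G ∘ step G m , λ m<r r≤n m<s s≤n ∥ →
      [ (λ (r<1+m , _) → contradiction (≤-pred r<1+m) (<⇒≱ m<r))
      , (λ (m+1<r , m+1<s) → hit m+1<r r≤n m+1<s s≤n ∥) ]′ (incomparable-same-side eq′ ∥)

-- The lower bound.

atMostTwo : ∀ {A : Set} → A → (xs : List A) → length xs < 3 →
            ∃ λ x → ∃ λ y → ∀ {z} → z ∈ xs → z ≡ x ⊎ z ≡ y
atMostTwo a []           _ = a , a , λ ()
atMostTwo _ (x ∷ [])     _ = x , x , λ { (here eq) → inj₁ eq }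
atMostTwo _ (x ∷ y ∷ []) _ = x , y , λ { (here eq) → inj₁ eq ; (there (here eq)) → inj₂ eq }
atMostTwo _ (_ ∷ _ ∷ _ ∷ _) (s≤s (s≤s (s≤s ())))

module Lower {n k} (F : Family n) (sat : IsInducedSaturated n (antichain (suc k)) F)
             (3≤k : 3 ≤ k) (k<n : k < n) where
  open Saturated F sat

  abstract
    -- Dilworth's theorem also yields an antichain with as many members as colours, so more than `k`
    -- colours are impossible.
    colouring : Colouring k (members F)
    colouring with dilworth (members F)
    ... | k′ , C , A = colouring-≤ (≮⇒≥ λ k<k′ → no-antichain (antichain-≤ k<k′ A)) C

  colour : Subset n → ℕ
  colour = proj₁ colouring

  hasColour? : ∀ (i : Fin k) S → Dec (colour S ≡ toℕ i)
  hasColour? i S = colour S ℕ.≟ toℕ i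

  class-chain : ∀ i {S T} → S ∈ filter (hasColour? i) (members F) →
                T ∈ filter (hasColour? i) (members F) → Comparable S T
  class-chain i S∈ T∈ =
    let S∈F , cS = ∈-filter⁻ (hasColour? i) S∈
        T∈F , cT = ∈-filter⁻ (hasColour? i) T∈
    in  proj₂ (proj₂ colouring) S∈F T∈F (trans cS (sym cT))

  chain : Fin k → FullChain n
  chain i = proj₁ (fullChain _ (class-chain i))

  on-chain : ∀ i {S} → S ∈ members F → colour S ≡ toℕ i → S ≡ at (chain i) ∣ S ∣
  on-chain i S∈F cS = proj₂ (fullChain _ (class-chain i)) (∈-filter⁺ (hasColour? i) S∈F cS)

  abstract
    -- The antichain obstructing `Z` uses every colour, so it has a member on each full chain; `r i`
    -- is the level of its member on chain `i`.
    obstructed : ∀ {Z} → Z ∉ members F → ∃ λ (r : Fin k → ℕ) →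
      (∀ i → r i ≤ n) × (∀ i → ¬ Comparable Z (at (chain i) (r i))) ×
      (∀ {i j} → i ≢ j → Incomparable (chain i) (chain j) (r i) (r j))
    obstructed {Z} Z∉F = (λ i → ∣ f (t i) ∣) , (λ i → ∣p∣≤n (f (t i))) ,
      (λ i → subst (¬_ ∘ Comparable Z) (f≡ i) (proj₂ (f∈ (t i)))) ,
      λ {i} {j} i≢j → subst (¬_) (cong₂ Comparable (f≡ i) (f≡ j)) λ
        { (inj₁ fi⊆fj) → i≢j (t-injective (f-anti _ _ fi⊆fj))
        ; (inj₂ fj⊆fi) → i≢j (sym (t-injective (f-anti _ _ fj⊆fi))) }
      where
      f : Fin k → Subset n
      f = proj₁ (obstruction Z∉F)

      f-anti : ∀ i j → f i ⊆ f j → i ≡ j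
      f-anti = proj₂ (proj₂ (obstruction Z∉F))

      f∈ : ∀ i → f i ∈ members F × ¬ Comparable Z (f i)
      f∈ i = ∈-filter⁻ (λ S → ¬? (comparable? Z S)) (proj₁ (proj₂ (obstruction Z∉F)) i)

      hit : ∀ (i : Fin k) → ∃ λ (s : Fin k) → colour (f s) ≡ toℕ i
      hit = colour-hit colouring (f , proj₁ ∘ f∈ , f-anti)

      t : Fin k → Fin k
      t i = proj₁ (hit i)

      t-injective : ∀ {i j} → t i ≡ t j → i ≡ j
      t-injective {i} {j} eq = toℕ-injective
        (trans (sym (proj₂ (hit i))) (trans (cong (colour ∘ f) eq) (proj₂ (hit j))))

      f≡ : ∀ i → f (t i) ≡ at (chain i) ∣ f (t i) ∣
      f≡ i = on-chain i (proj₁ (f∈ (t i))) (proj₂ (hit i))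

  -- If the set were missing, its obstruction would have a member on the same chain, yet
  -- incomparable to it.
  at∈F : ∀ i m → at (chain i) m ∈ members F
  at∈F i m = decidable-stable (at (chain i) m ∈F? members F) λ at∉F →
    let r , _ , ∥ , _ = obstructed at∉F in ∥ i (at-comparable (chain i) m (r i))

  -- As `k < n`, the singletons would give an antichain of size `suc k`. A missing set is wanted for
  -- its obstruction, which shows that any two of the chains contain incomparable sets.
  missing : ∃ λ Z → Z ∉ members F
  missing with Finₚ.all? (λ z → ⁅ z ⁆ ∈F? members F)
  ... | no ¬all = let z , z∉ = Finₚ.¬∀⟶∃¬ n _ (λ z → ⁅ z ⁆ ∈F? members F) ¬all in ⁅ z ⁆ , z∉
  ... | yes all = contradiction (singleton , (λ i → all (inject≤ i k<n)) , anti) no-antichain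
    where
    singleton : Fin (suc k) → Subset n
    singleton i = ⁅ inject≤ i k<n ⁆

    anti : ∀ i j → singleton i ⊆ singleton j → i ≡ j
    anti i j i⊆j = inject≤-injective k<n k<n i j (x∈⁅y⁆⇒x≡y _ (i⊆j (x∈⁅x⁆ _)))

  module _ {i j} (i≢j : i ≢ j) {m} (0<m : 0 < m) (m<n : m < n)
           (eq : at (chain i) m ≡ at (chain j) m) where
    private
      G = chain i
      H = chain j
      X = at G m

      ∣X∣≡m : ∣ X ∣ ≡ m
      ∣X∣≡m = size G (<⇒≤ m<n)

    -- Otherwise the obstruction has incomparable members on chains `i` and `j`, both on one side of
    -- `X`. Below `X`, one of them avoids `u` and lies inside the exchanged set; above `X`, one
    -- contains `v` and includes the exchanged set.
    exchange∈F : ∀ {u v} → Removable G H m u → Addable G H m v → exchange X u v ∈ members F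
    exchange∈F {u} {v} (u∈X , keep) (v∉X , hit) = decidable-stable (exchange X u v ∈F? members F) λ Z∉F →
      let r , r≤n , ∥Z , ∥ = obstructed Z∉F in
      [ (λ (ri<m , rj<m) →
          [ (λ u∉G → ∥Z i (inj₂ (inside-X (at-mono G (<⇒≤ ri<m)) u∉G)))
          , (λ u∉H → ∥Z j (inj₂ (inside-X (across′ G H eq (<⇒≤ rj<m) ≤-refl) u∉H))) ]′
          (keep ri<m rj<m (∥ i≢j)))
      , (λ (m<ri , m<rj) →
          [ (λ v∈G → ∥Z i (inj₁ (outside-X (at-mono G (<⇒≤ m<ri)) v∈G)))
          , (λ v∈H → ∥Z j (inj₁ (outside-X (across G H eq ≤-refl (<⇒≤ m<rj)) v∈H))) ]′
          (hit m<ri (r≤n i) m<rj (r≤n j) (∥ i≢j))) ]′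
      (incomparable-same-side G H eq (∥ i≢j))
      where
      inside-X : ∀ {S} → S ⊆ X → u ∉ˢ S → S ⊆ exchange X u v
      inside-X S⊆X u∉S x∈S = ∈-exchange⁺ (S⊆X x∈S) (λ { refl → u∉S x∈S })

      outside-X : ∀ {S} → X ⊆ S → v ∈ˢ S → exchange X u v ⊆ S
      outside-X X⊆S v∈S x∈Z = [ X⊆S , (λ { refl → v∈S }) ]′ (∈-exchange⁻ x∈Z)

    removable-exists : ∃ λ u → Removable G H m u
    removable-exists with removable G H m (<⇒≤ m<n) eq
    ... | inj₂ (u , _ , _ , u-rem , _) = u , u-rem
    -- Without incomparable pairs below `m` the condition is vacuous, and any element of the
    -- non-empty set `X` serves.
    ... | inj₁ comp =
      let u , u∈X , _ = ⊈⇒∃ {p = X} {⊥} λ X⊆⊥ →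
            <⇒≱ 0<m (subst₂ _≤_ ∣X∣≡m (∣⊥∣≡0 n) (p⊆q⇒∣p∣≤∣q∣ X⊆⊥))
      in  u , u∈X , λ r<m s<m ∥ → ⊥-elim (∥ (comp r<m s<m))

    addable-exists : ∃ λ v → Addable G H m v
    addable-exists with addable G H (n ∸ m) m (m+[n∸m]≡n (<⇒≤ m<n)) eq
    ... | inj₂ (v , _ , _ , v-add , _) = v , v-add
    ... | inj₁ comp =
      let v , _ , v∉X = ⊈⇒∃ {p = ⊤} {X} λ ⊤⊆X →
            <⇒≱ m<n (subst₂ _≤_ (∣⊤∣≡n n) ∣X∣≡m (p⊆q⇒∣p∣≤∣q∣ ⊤⊆X))
      in  v , v∉X , λ m<r r≤n m<s s≤n ∥ → ⊥-elim (∥ (comp m<r r≤n m<s s≤n))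

    -- An exchanged set has size `m` and contains `v`, which is not in `X`, so it would have to be
    -- `Y`. Two choices of `u` or of `v` give different exchanged sets.
    third-set : ∀ Y → ¬ (∀ {S} → S ∈ members F → ∣ S ∣ ≡ m → S ≡ X ⊎ S ≡ Y)
    third-set Y only = result (removable G H m (<⇒≤ m<n) eq)
                              (addable G H (n ∸ m) m (m+[n∸m]≡n (<⇒≤ m<n)) eq)
      where
      exchange≡Y : ∀ {u v} → Removable G H m u → Addable G H m v → exchange X u v ≡ Y
      exchange≡Y {u} {v} u-rem@(u∈X , _) v-add@(v∉X , _)
        with only (exchange∈F u-rem v-add) (trans (∣exchange∣ u∈X v∉X) ∣X∣≡m)
      ... | inj₁ ≡X = contradiction (subst (v ∈ˢ_) ≡X (∈-exchange {p = X} {u})) v∉X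
      ... | inj₂ ≡Y = ≡Y

      result : _ → _ → Empty.⊥
      -- Removing `u′` keeps `u`, removing `u` does not, yet both results would be `Y`.
      result (inj₂ (u , u′ , u≢u′ , u-rem , u′-rem)) _ =
        let v , v-add = addable-exists in
        ∉-exchange {p = X} (∈∉⇒≢ (proj₁ u-rem) (proj₁ v-add))
          (subst (u ∈ˢ_) (trans (exchange≡Y u′-rem v-add) (sym (exchange≡Y u-rem v-add)))
            (∈-exchange⁺ (proj₁ u-rem) u≢u′))
      result (inj₁ _) (inj₂ (v , v′ , v≢v′ , v-add , v′-add)) =
        let u , u-rem = removable-exists in
        [ proj₁ v-add , v≢v′ ]′
          (∈-exchange⁻ (subst (v ∈ˢ_) (trans (exchange≡Y u-rem v-add) (sym (exchange≡Y u-rem v′-add)))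
            (∈-exchange {p = X} {u})))
      -- Here the two chains have no incomparable pair on either side of `X`, against the
      -- obstruction of a missing set.
      result (inj₁ low) (inj₁ high) =
        let r , r≤n , _ , ∥ = obstructed (proj₂ missing) in
        [ (λ (ri<m , rj<m) → ∥ i≢j (low ri<m rj<m))
        , (λ (m<ri , m<rj) → ∥ i≢j (high m<ri (r≤n i) m<rj (r≤n j))) ]′
        (incomparable-same-side G H eq (∥ i≢j))

  -- All `k` chains pass through the level inside `F`. With at most two sets there, two of the at
  -- least three chains share one by the pigeonhole principle, and `third-set` applies.
  3≤level : ∀ {m} → 0 < m → m < n → 3 ≤ length (level m (members F))
  3≤level {m} 0<m m<n = ≮⇒≥ λ short →
    let X , Y , only = atMostTwo ⊤ (level m (members F)) short
        only′ = λ {S} S∈F ∣S∣≡m → only {S} (∈-filter⁺ (λ S → ∣ S ∣ ℕ.≟ m) S∈F ∣S∣≡m)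
        which = λ i → only′ (at∈F i m) (size (chain i) (<⇒≤ m<n))
        i , j , i<j , same = Finₚ.pigeonhole 3≤k ([ (λ _ → zero) , (λ _ → suc zero) ]′ ∘ which)
    in  collision only′ (Finₚ.<⇒≢ i<j) (which i) (which j) same
    where
    collision : ∀ {X Y} → (∀ {S} → S ∈ members F → ∣ S ∣ ≡ m → S ≡ X ⊎ S ≡ Y) → ∀ {i j} → i ≢ j →
      (a : at (chain i) m ≡ X ⊎ at (chain i) m ≡ Y) (b : at (chain j) m ≡ X ⊎ at (chain j) m ≡ Y) →
      [ (λ _ → zero {1}) , (λ _ → suc zero) ]′ a ≡ [ (λ _ → zero) , (λ _ → suc zero) ]′ b → Empty.⊥
    collision _ _ (inj₁ _) (inj₂ _) ()
    collision _ _ (inj₂ _) (inj₁ _) ()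
    collision {Y = Y} only i≢j (inj₁ refl) (inj₁ eq) _ = third-set i≢j 0<m m<n (sym eq) Y only
    collision {X = X} only i≢j (inj₂ refl) (inj₂ eq) _ =
      third-set i≢j 0<m m<n (sym eq) X (λ S∈F ∣S∣ → swap (only S∈F ∣S∣))

  1≤level : ∀ {m} → m ≤ n → 1 ≤ length (level m (members F))
  1≤level {m} m≤n = ∈-length (∈-filter⁺ (λ S → ∣ S ∣ ℕ.≟ m) (at∈F i m) (size (chain i) m≤n))
    where
    i : Fin k
    i = fromℕ< (≤-trans (s≤s z≤n) 3≤k)

  private
    #level #below : ℕ → ℕ
    #level m = length (level m (members F))
    #below m = length (below m (members F))

  below-bound : ∀ m → m < n → 1 + 3 * m ≤ #below (suc m)
  below-bound zero    _   = begin
    1                    ≤⟨ 1≤level z≤n ⟩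
    #level 0             ≤⟨ m≤n+m _ _ ⟩
    #below 0 + #level 0  ≡⟨ length-below 0 (members F) ⟨
    #below 1             ∎
    where open ≤-Reasoning
  below-bound (suc m) m<n = begin
    1 + 3 * suc m                    ≡⟨ cong suc (trans (*-suc 3 m) (+-comm 3 (3 * m))) ⟩
    1 + 3 * m + 3                    ≤⟨ +-mono-≤ (below-bound m (<⇒≤ m<n)) (3≤level (s≤s z≤n) m<n) ⟩
    #below (suc m) + #level (suc m)  ≡⟨ length-below (suc m) (members F) ⟨
    #below (suc (suc m))             ∎
    where open ≤-Reasoning

  -- Levels `0` and `n` contribute one set each and the `n - 1` inner levels three each.
  lower : 3 * n ∸ 1 ≤ ∣ F ∣F
  lower = bound n refl
    where
    bound : ∀ l → l ≡ n → 3 * l ∸ 1 ≤ ∣ F ∣F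
    bound zero    _    = z≤n
    bound (suc l) refl = begin
      3 * suc l ∸ 1        ≡⟨ cong (_∸ 1) (*-suc 3 l) ⟩
      2 + 3 * l            ≡⟨ +-comm 1 (1 + 3 * l) ⟩
      1 + 3 * l + 1        ≤⟨ +-mono-≤ (below-bound l ≤-refl) (1≤level ≤-refl) ⟩
      #below n + #level n  ≡⟨ length-below n (members F) ⟨
      #below (suc n)       ≤⟨ length-filter (λ S → ∣ S ∣ ℕ.<? suc n) (members F) ⟩
      ∣ F ∣F               ∎
      where open ≤-Reasoning

-- The upper bound.

length-≤ : ∀ {A : Set} {l} {xs : List A} → Unique xs → (f : ∀ {x} → x ∈ xs → Fin l) →
           (∀ {x y} (x∈ : x ∈ xs) (y∈ : y ∈ xs) → f x∈ ≡ f y∈ → x ≡ y) → length xs ≤ l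
length-≤ u f f-inj = Finₚ.injective⇒≤ {f = λ i → f (∈-lookup i)}
  (λ eq → lookup-unique u (f-inj (∈-lookup _) (∈-lookup _) eq))

tabulate-width : ∀ {n k} (f : Fin k → Subset n) → ¬ Antichain (suc k) (tabulate f)
tabulate-width f (g , g∈ , g-anti) = 1+n≰n (Finₚ.injective⇒≤ {f = index} index-injective)
  where
  index : Fin (suc _) → Fin _
  index i = proj₁ (∈-tabulate⁻ (g∈ i))

  g≡ : ∀ i → g i ≡ f (index i)
  g≡ i = proj₂ (∈-tabulate⁻ (g∈ i))

  index-injective : ∀ {i j} → index i ≡ index j → i ≡ j
  index-injective {i} {j} eq =
    g-anti i j (⊆-reflexive (trans (g≡ i) (trans (cong f eq) (sym (g≡ j)))))

module Upper {n k₁} (2≤k₁ : 2 ≤ k₁) (k<n : suc k₁ < n) where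
  private
    k h l : ℕ
    k = suc k₁
    h = k₁ / 2
    -- The largest index is `k₁`, so the pairs live on the two low points `0`, `1` and the high
    -- points `2` to `2 + h`.
    l = 3 + h

    l≤n : l ≤ n
    l≤n = ≤-trans (s≤s (s≤s (m/n<m k₁ 2 {{>-nonZero (≤-trans (s≤s z≤n) 2≤k₁)}} ≤-refl))) k<n

  lowℕ highℕ : Fin k → ℕ
  lowℕ j  = toℕ j % 2
  highℕ j = 2 + toℕ j / 2

  low<2 : ∀ j → lowℕ j < 2
  low<2 j = m%n<n (toℕ j) 2

  low≢high : ∀ i j → lowℕ i ≢ highℕ j
  low≢high i j eq = <⇒≱ (low<2 i) (≤-trans (m≤m+n 2 _) (≤-reflexive (sym eq)))

  low<l : ∀ j → lowℕ j < l
  low<l j = ≤-trans (low<2 j) (s≤s (s≤s z≤n))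

  high<l : ∀ j → highℕ j < l
  high<l j = s≤s (s≤s (s≤s (/-monoˡ-≤ 2 (≤-pred (toℕ<n j)))))

  low high : Fin k → Fin n
  low j  = fromℕ< (≤-trans (low<l j) l≤n)
  high j = fromℕ< (≤-trans (high<l j) l≤n)

  pair : Fin k → Subset n
  pair j = ⁅ low j ⁆ ∪ ⁅ high j ⁆

  low∈pair : ∀ j → low j ∈ˢ pair j
  low∈pair j = x∈p∪q⁺ (inj₁ (x∈⁅x⁆ (low j)))

  high∈pair : ∀ j → high j ∈ˢ pair j
  high∈pair j = x∈p∪q⁺ (inj₂ (x∈⁅x⁆ (high j)))

  ∈-pair : ∀ {x} j → x ∈ˢ pair j → toℕ x ≡ lowℕ j ⊎ toℕ x ≡ highℕ j
  ∈-pair j x∈ with x∈p∪q⁻ ⁅ low j ⁆ ⁅ high j ⁆ x∈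
  ... | inj₁ x∈low  = inj₁ (trans (cong toℕ (x∈⁅y⁆⇒x≡y (low j) x∈low)) (Finₚ.toℕ-fromℕ< _))
  ... | inj₂ x∈high = inj₂ (trans (cong toℕ (x∈⁅y⁆⇒x≡y (high j) x∈high)) (Finₚ.toℕ-fromℕ< _))

  pair-< : ∀ {x} j → x ∈ˢ pair j → toℕ x < l
  pair-< j x∈ with ∈-pair j x∈
  ... | inj₁ eq = subst (_< l) (sym eq) (low<l j)
  ... | inj₂ eq = subst (_< l) (sym eq) (high<l j)

  -- Low points are below `2` and high points are not, so an inclusion matches low with low and high
  -- with high; remainder and quotient by `2` then recover the index.
  pair-antichain : ∀ i j → pair i ⊆ pair j → i ≡ j
  pair-antichain i j i⊆j = toℕ-injective (begin
    toℕ i                         ≡⟨ m≡m%n+[m/n]*n (toℕ i) 2 ⟩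
    toℕ i % 2 + (toℕ i / 2) * 2   ≡⟨ cong₂ (λ r q → r + q * 2) remainders quotients ⟩
    toℕ j % 2 + (toℕ j / 2) * 2   ≡⟨ m≡m%n+[m/n]*n (toℕ j) 2 ⟨
    toℕ j                         ∎)
    where
    open ≡-Reasoning

    remainders : lowℕ i ≡ lowℕ j
    remainders with ∈-pair j (i⊆j (low∈pair i))
    ... | inj₁ eq = trans (sym (Finₚ.toℕ-fromℕ< _)) eq
    ... | inj₂ eq = contradiction (trans (sym (Finₚ.toℕ-fromℕ< _)) eq) (low≢high i j)

    quotients : toℕ i / 2 ≡ toℕ j / 2
    quotients with ∈-pair j (i⊆j (high∈pair i))
    ... | inj₁ eq = contradiction (trans (sym eq) (Finₚ.toℕ-fromℕ< _)) (low≢high j i)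
    ... | inj₂ eq = suc-injective (suc-injective (trans (sym (Finₚ.toℕ-fromℕ< _)) eq))

  pairs : List (Subset n)
  pairs = tabulate pair

  pairs-unique : Unique pairs
  pairs-unique = Uniqueₚ.tabulate⁺ (λ eq → pair-antichain _ _ (⊆-reflexive eq))

  module _ (F : Family n) (no-antichain : ¬ Antichain (suc k) (members F))
           (pair∈F : ∀ j → pair j ∈ members F) where
    private
      #level #below : ℕ → ℕ
      #level m = length (level m (members F))
      #below m = length (below m (members F))

    -- A singleton off the first `l` points is disjoint from all `k` pairs and would extend them to
    -- an antichain of size `suc k`.
    singleton-of : ∀ {S} → S ∈ level 1 (members F) → ∃ λ z → S ≡ ⁅ z ⁆ × toℕ z < l
    singleton-of {S} S∈ = z , S≡ , ≰⇒> λ l≤z → no-antichain (antichain-∷ S∈F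
      (pair , (λ j → ∈-filter⁺ (λ T → ¬? (comparable? S T)) (pair∈F j) (incomparable l≤z j)) ,
       pair-antichain))
      where
      S∈F : S ∈ members F
      S∈F = proj₁ (∈-filter⁻ (λ S → ∣ S ∣ ℕ.≟ 1) S∈)

      ∣S∣≡1 : ∣ S ∣ ≡ 1
      ∣S∣≡1 = proj₂ (∈-filter⁻ (λ S → ∣ S ∣ ℕ.≟ 1) {xs = members F} S∈)

      element : ∃ λ z → z ∈ˢ S × z ∉ˢ ⊥
      element = ⊈⇒∃ λ S⊆⊥ → 1+n≰n (subst₂ _≤_ ∣S∣≡1 (∣⊥∣≡0 n) (p⊆q⇒∣p∣≤∣q∣ S⊆⊥))

      z : Fin n
      z = proj₁ element

      S≡ : S ≡ ⁅ z ⁆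
      S≡ = comparable⇒≡ (inj₂ λ x∈ → subst (_∈ˢ S) (sym (x∈⁅y⁆⇒x≡y z x∈)) (proj₁ (proj₂ element)))
             (trans ∣S∣≡1 (sym (∣⁅x⁆∣≡1 z)))

      incomparable : l ≤ toℕ z → ∀ j → ¬ Comparable S (pair j)
      incomparable l≤z j (inj₁ S⊆) = <⇒≱ (pair-< j (S⊆ (proj₁ (proj₂ element)))) l≤z
      incomparable l≤z j (inj₂ ⊆S) = <⇒≱ (low<l j) (≤-trans l≤z (≤-reflexive
        (trans (cong toℕ (sym (x∈⁅y⁆⇒x≡y z (subst (low j ∈ˢ_) S≡ (⊆S (low∈pair j))))))
               (Finₚ.toℕ-fromℕ< _))))

    level-unique : ∀ m → Unique (level m (members F))
    level-unique m = Uniqueₚ.filter⁺ (λ S → ∣ S ∣ ℕ.≟ m) (unique F)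

    level-0 : #level 0 ≤ 1
    level-0 = length-≤ (level-unique 0) (λ _ → zero) λ S∈ T∈ _ → trans (empty S∈) (sym (empty T∈))
      where
      empty : ∀ {S} → S ∈ level 0 (members F) → S ≡ ⊥
      empty S∈ = sym (comparable⇒≡ (inj₁ ⊥⊆) (trans (∣⊥∣≡0 n)
        (sym (proj₂ (∈-filter⁻ (λ S → ∣ S ∣ ℕ.≟ 0) {xs = members F} S∈)))))

    level-n : #level n ≤ 1
    level-n = length-≤ (level-unique n) (λ _ → zero) λ S∈ T∈ _ → trans (full S∈) (sym (full T∈))
      where
      full : ∀ {S} → S ∈ level n (members F) → S ≡ ⊤
      full S∈ = ∣p∣≡n⇒p≡⊤ (proj₂ (∈-filter⁻ (λ S → ∣ S ∣ ℕ.≟ n) {xs = members F} S∈))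

    level-1 : #level 1 ≤ l
    level-1 = length-≤ (level-unique 1) (λ S∈ → fromℕ< (proj₂ (proj₂ (singleton-of S∈))))
      λ S∈ T∈ eq →
        let z , S≡ , z< = singleton-of S∈
            w , T≡ , w< = singleton-of T∈
        in  trans S≡ (trans (cong ⁅_⁆ (toℕ-injective (Finₚ.fromℕ<-injective _ _ z< w< eq))) (sym T≡))

    below-bound : ∀ m → #below (2 + m) ≤ m * k + (1 + l)
    below-bound zero = begin
      #below 2                        ≡⟨ length-below 1 (members F) ⟩
      #below 1 + #level 1             ≡⟨ cong (_+ #level 1) (length-below 0 (members F)) ⟩
      #below 0 + #level 0 + #level 1  ≡⟨ cong (λ b → b + #level 0 + #level 1) #below0≡0 ⟩
      #level 0 + #level 1             ≤⟨ +-mono-≤ level-0 level-1 ⟩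
      1 + l                           ∎
      where
      open ≤-Reasoning
      #below0≡0 : #below 0 ≡ 0
      #below0≡0 = cong length
        (filter-none (λ S → ∣ S ∣ ℕ.<? 0) {members F} (All.universal (λ _ ()) _))
    below-bound (suc m) = begin
      #below (3 + m)                   ≡⟨ length-below (2 + m) (members F) ⟩
      #below (2 + m) + #level (2 + m)  ≤⟨ +-mono-≤ (below-bound m) level-k ⟩
      m * k + (1 + l) + k              ≡⟨ +-comm (m * k + (1 + l)) k ⟩
      k + (m * k + (1 + l))            ≡⟨ +-assoc k (m * k) (1 + l) ⟨
      suc m * k + (1 + l)              ∎
      where
      open ≤-Reasoning
      level-k : #level (2 + m) ≤ k
      level-k = length-level-≤ (2 + m) (unique F) no-antichain

    -- Levels `0` and `n` hold at most one set each, level `1` at most `l`, and each of the `n - 2`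
    -- others at most `k`.
    size-bound : ∣ F ∣F ≤ (n ∸ 2) * k + (2 + l)
    size-bound = begin
      ∣ F ∣F                           ≡⟨ cong length all-below ⟨
      #below (suc n)                   ≡⟨ length-below n (members F) ⟩
      #below n + #level n              ≡⟨ cong (λ m → #below m + #level n) (m+[n∸m]≡n 2≤n) ⟨
      #below (2 + (n ∸ 2)) + #level n  ≤⟨ +-mono-≤ (below-bound (n ∸ 2)) level-n ⟩
      (n ∸ 2) * k + (1 + l) + 1        ≡⟨ +-assoc ((n ∸ 2) * k) (1 + l) 1 ⟩
      (n ∸ 2) * k + (1 + l + 1)        ≡⟨ cong ((n ∸ 2) * k +_) (+-comm (1 + l) 1) ⟩
      (n ∸ 2) * k + (2 + l)            ∎
      where
      open ≤-Reasoning
      2≤n : 2 ≤ n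
      2≤n = ≤-trans (s≤s (s≤s z≤n)) k<n

      all-below : below (suc n) (members F) ≡ members F
      all-below = filter-all (λ S → ∣ S ∣ ℕ.<? suc n) (All.universal (λ S → s≤s (∣p∣≤n S)) _)

  upper : SatStar≤ n (antichain (suc k)) ((n ∸ 2) * k + (2 + l))
  upper with saturate k pairs pairs-unique (tabulate-width pair)
  ... | F , sat , pairs⊆F =
    F , sat , size-bound F (Saturated.no-antichain F sat) (λ j → pairs⊆F (∈-tabulate⁺ {f = pair} j))

-- The logarithmic estimate and the theorem.

n<2^n : ∀ n → n < 2 ^ n
n<2^n zero    = s≤s z≤n
n<2^n (suc n) = begin-strict
  suc n          ≤⟨ n<2^n n ⟩
  2 ^ n          <⟨ m<m*n (2 ^ n) 2 {{m^n≢0 2 n}} ≤-refl ⟩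
  2 ^ n * 2      ≡⟨ *-comm (2 ^ n) 2 ⟩
  2 ^ suc n      ∎
  where open ≤-Reasoning

n²≤2^[1+n] : ∀ n → n * n ≤ 2 ^ suc n
n²≤2^[1+n] zero    = z≤n
n²≤2^[1+n] (suc n) = begin
  suc n * suc n                   ≤⟨ n≤1+n _ ⟩
  -- The added unit allows an identity free of subtraction: `(n + 1)² + 1 = n² + 2 (n + 1)`.
  suc (suc n * suc n)             ≡⟨ square n ⟩
  n * n + 2 * suc n               ≤⟨ +-monoˡ-≤ (2 * suc n) (n²≤2^[1+n] n) ⟩
  2 ^ suc n + 2 * suc n           ≤⟨ +-monoʳ-≤ (2 ^ suc n) (*-monoʳ-≤ 2 (n<2^n n)) ⟩
  2 ^ suc n + 2 ^ suc n           ≡⟨ cong (2 ^ suc n +_) (+-identityʳ (2 ^ suc n)) ⟨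
  2 ^ suc (suc n)                 ∎
  where
  open ≤-Reasoning
  square : ∀ n → suc (suc n * suc n) ≡ n * n + 2 * suc n
  square = solve-∀

n^n≤2^2^m : ∀ n m → suc n ≤ m → n ^ n ≤ 2 ^ (2 ^ m)
n^n≤2^2^m n m n<m = begin
  n ^ n              ≤⟨ ^-monoˡ-≤ n (<⇒≤ (n<2^n n)) ⟩
  (2 ^ n) ^ n        ≡⟨ ^-*-assoc 2 n n ⟩
  2 ^ (n * n)        ≤⟨ ^-monoʳ-≤ 2 (n²≤2^[1+n] n) ⟩
  2 ^ (2 ^ suc n)    ≤⟨ ^-monoʳ-≤ 2 (^-monoʳ-≤ 2 n<m) ⟩
  2 ^ (2 ^ m)        ∎
  where open ≤-Reasoning

-- `D` is the saving up to the absolute constant `C`. Taking logarithms twice, the last inequality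
-- reads `log₂ k + log₂ log₂ k ≤ 2 D`.
theorem3 : Σ ℕ λ C → ∀ (n k : ℕ) → 3 ≤ k → k < n →
    SatStar≥ n (antichain (suc k)) (3 * n ∸ 1) ×
    Σ ℕ (λ s → SatStar≤ n (antichain (suc k)) s ×
    Σ ℕ (λ D → s + D ≡ (n ∸ 1) * k + C × k ^ k ≤ 2 ^ (2 ^ (2 * D))))
-- With `p = n - 2` and `l = 3 + k₁ / 2` the upper bound is `p * k + (5 + k₁ / 2)`; adding
-- `D = k - k₁ / 2` gives `(n - 1) * k + 5`.
theorem3 = 5 , λ
  { n@(suc (suc p)) k@(suc k₁) 3≤k k<n →
    (λ F sat → Lower.lower F sat 3≤k k<n) ,
    p * k + (5 + k₁ / 2) , Upper.upper (≤-pred 3≤k) k<n ,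
    k ∸ k₁ / 2 , total p k₁ , n^n≤2^2^m k _ (exponent k₁)
  ; (suc zero) (suc _) _ (s≤s ()) }
  where
  half≤ : ∀ k₁ → k₁ / 2 ≤ suc k₁
  half≤ k₁ = m≤n⇒m≤1+n (m/n≤m k₁ 2)

  total : ∀ p k₁ → p * suc k₁ + (5 + k₁ / 2) + (suc k₁ ∸ k₁ / 2) ≡ suc p * suc k₁ + 5
  total p k₁ = begin
    p * suc k₁ + (5 + k₁ / 2) + (suc k₁ ∸ k₁ / 2)   ≡⟨ regroup (p * suc k₁) (k₁ / 2) (suc k₁ ∸ k₁ / 2) ⟩
    k₁ / 2 + (suc k₁ ∸ k₁ / 2) + p * suc k₁ + 5
      ≡⟨ cong (λ t → t + p * suc k₁ + 5) (m+[n∸m]≡n (half≤ k₁)) ⟩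
    suc p * suc k₁ + 5                              ∎
    where
    open ≡-Reasoning
    regroup : ∀ a h d → a + (5 + h) + d ≡ h + d + a + 5
    regroup = solve-∀

  -- This is `k + 1 ≤ 2 D`, the hypothesis of `n^n≤2^2^m`; it holds because twice `k₁ / 2` is at
  -- most `k₁`.
  exponent : ∀ k₁ → 2 + k₁ ≤ 2 * (suc k₁ ∸ k₁ / 2)
  exponent k₁ = +-cancelʳ-≤ (2 * (k₁ / 2)) _ _ (begin
    2 + k₁ + 2 * (k₁ / 2)                           ≡⟨ cong (2 + k₁ +_) (*-comm 2 (k₁ / 2)) ⟩
    2 + k₁ + k₁ / 2 * 2                             ≤⟨ +-monoʳ-≤ (2 + k₁) (m/n*n≤m k₁ 2) ⟩
    2 + k₁ + k₁                                     ≡⟨ double k₁ ⟩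
    2 * suc k₁                                      ≡⟨ cong (2 *_) (m∸n+n≡m (half≤ k₁)) ⟨
    2 * (suc k₁ ∸ k₁ / 2 + k₁ / 2)                  ≡⟨ *-distribˡ-+ 2 (suc k₁ ∸ k₁ / 2) (k₁ / 2) ⟩
    2 * (suc k₁ ∸ k₁ / 2) + 2 * (k₁ / 2)            ∎)
    where
    open ≤-Reasoning
    double : ∀ m → 2 + m + m ≡ 2 * suc m
    double = solve-∀
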